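{- For every prime $p$ and every integer $k \geq 1$ there is an integer $N$ such that, if $M$ is a simple $\mathrm{GF}(p)$-representable matroid with rank at least $N$ and girth at least five, then $M$ contains a rank-$k$ independent flat (that is, a flat of rank $k$ that is an independent set of $M$).
   Context: Matroids are finite. $\mathrm{GF}(p)$ is the field with $p$ elements. The girth of a matroid is the minimum size of a circuit, taken to be $\infty$ if there are no circuits. -}

module Defs where

open import Algebra.Apartness.Bundles using (HeytingField; HeytingCommutativeRing)
open import Algebra.Bundles using (CommutativeRing)
open import Algebra.Definitions using (Invertible)
open import Data.Empty using (⊥-elim)
open import Data.Fin.Base as Fin using (Fin; toℕ)
import Data.Fin.Properties as Fin
open import Data.Fin.Subset hiding (_-_)
open import Data.Fin.Subset.Properties using (_⊆?_; _⊂?_; anySubset?)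
open import Data.List.Base as List using (List; _++_; filter)
import Data.List.Extrema
import Data.List.Extrema.Nat as ℕ-Extrema
import Data.List.Membership.Propositional as List
open import Data.List.Membership.Propositional.Properties
  using (∈-map⁺; ∈-++⁺ˡ; ∈-++⁺ʳ)
open import Data.List.Relation.Unary.Any using (here)
open import Data.Nat.Base as ℕ using (ℕ; zero; suc; _≤_; _<_; NonZero; >-nonZero)
import Data.Nat.Coprimality as Coprimality
open import Data.Nat.DivMod
open import Data.Nat.GCD using (module Bézout)
open import Data.Nat.Primality using (Prime; prime⇒nonZero; prime⇒nonTrivial)
import Data.Nat.Properties as ℕ
open import Data.Product.Base using (∃-syntax; Σ-syntax; _×_; _,_)
open import Data.Vec.Base using ([]; _∷_)
open import Data.Vec.Functional using (Vector)
open import Function.Base using (_∘_)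
open import Function.Bundles using (_⇔_)
open import Level using (Level; 0ℓ)
open import Relation.Binary.Bundles using (TotalOrder)
open import Relation.Binary.Construct.Add.Supremum.NonStrict _≤_
  using (≤⁺-isTotalOrder-≡)
open import Relation.Binary.PropositionalEquality
import Relation.Binary.Properties.DecSetoid as DecSetoidProperties
open import Relation.Nullary.Construct.Add.Supremum using (_⁺; [_]; ⊤⁺)
open import Relation.Nullary.Decidable using (¬?; _×-dec_; map′; decidable-stable)
open import Relation.Nullary.Negation using (¬_)
open import Relation.Unary using (Pred; Decidable)

private
  variable
    c ℓ₁ ℓ₂ : Level
    n : ℕ

module Residue (n : ℕ) .{{_ : NonZero n}} where

  infixl 6 _+_
  infixl 7 _*_
  infix  8 -_

  0# 1# : Fin n
  0# = 0 mod n
  1# = 1 mod n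

  _+_ _*_ : Fin n → Fin n → Fin n
  x + y = (toℕ x ℕ.+ toℕ y) mod n
  x * y = (toℕ x ℕ.* toℕ y) mod n

  -_ : Fin n → Fin n
  - x = (n ℕ.∸ toℕ x) mod n

  private
    toℕ-mod : ∀ a → toℕ (a mod n) ≡ a % n
    toℕ-mod a = Fin.toℕ-fromℕ< (m%n<n a n)

  mod-cong : ∀ a b → a % n ≡ b % n → a mod n ≡ b mod n
  mod-cong a b eq = Fin.fromℕ<-cong (a % n) (b % n) eq (m%n<n a n) (m%n<n b n)

  mod-toℕ : ∀ x → toℕ x mod n ≡ x
  mod-toℕ x = Fin.toℕ-injective
    (trans (toℕ-mod (toℕ x)) (m<n⇒m%n≡m (Fin.toℕ<n x)))

  +-mod : ∀ a b → (a mod n) + (b mod n) ≡ (a ℕ.+ b) mod n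
  +-mod a b = mod-cong _ (a ℕ.+ b) (trans
    (cong₂ (λ u v → (u ℕ.+ v) % n) (toℕ-mod a) (toℕ-mod b))
    (sym (%-distribˡ-+ a b n)))

  *-mod : ∀ a b → (a mod n) * (b mod n) ≡ (a ℕ.* b) mod n
  *-mod a b = mod-cong _ (a ℕ.* b) (trans
    (cong₂ (λ u v → (u ℕ.* v) % n) (toℕ-mod a) (toℕ-mod b))
    (sym (%-distribˡ-* a b n)))

  private
    open ≡-Reasoning

    +-comm : ∀ x y → x + y ≡ y + x
    +-comm x y = cong (_mod n) (ℕ.+-comm (toℕ x) (toℕ y))

    *-comm : ∀ x y → x * y ≡ y * x
    *-comm x y = cong (_mod n) (ℕ.*-comm (toℕ x) (toℕ y))

    +-assoc : ∀ x y z → (x + y) + z ≡ x + (y + z)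
    +-assoc x y z = begin
      (x + y) + z                             ≡⟨ cong ((x + y) +_) (mod-toℕ z) ⟨
      (x + y) + (toℕ z mod n)                 ≡⟨ +-mod _ _ ⟩
      (toℕ x ℕ.+ toℕ y ℕ.+ toℕ z) mod n       ≡⟨ cong (_mod n) (ℕ.+-assoc (toℕ x) (toℕ y) (toℕ z)) ⟩
      (toℕ x ℕ.+ (toℕ y ℕ.+ toℕ z)) mod n     ≡⟨ +-mod _ _ ⟨
      (toℕ x mod n) + (y + z)                 ≡⟨ cong (_+ (y + z)) (mod-toℕ x) ⟩
      x + (y + z)                             ∎

    *-assoc : ∀ x y z → (x * y) * z ≡ x * (y * z)
    *-assoc x y z = begin
      (x * y) * z                             ≡⟨ cong ((x * y) *_) (mod-toℕ z) ⟨
      (x * y) * (toℕ z mod n)                 ≡⟨ *-mod _ _ ⟩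
      (toℕ x ℕ.* toℕ y ℕ.* toℕ z) mod n       ≡⟨ cong (_mod n) (ℕ.*-assoc (toℕ x) (toℕ y) (toℕ z)) ⟩
      (toℕ x ℕ.* (toℕ y ℕ.* toℕ z)) mod n     ≡⟨ *-mod _ _ ⟨
      (toℕ x mod n) * (y * z)                 ≡⟨ cong (_* (y * z)) (mod-toℕ x) ⟩
      x * (y * z)                             ∎

    +-identityˡ : ∀ x → 0# + x ≡ x
    +-identityˡ x = begin
      0# + x                 ≡⟨ cong (0# +_) (mod-toℕ x) ⟨
      0# + (toℕ x mod n)     ≡⟨ +-mod 0 _ ⟩
      toℕ x mod n            ≡⟨ mod-toℕ x ⟩
      x                      ∎

    *-identityˡ : ∀ x → 1# * x ≡ x
    *-identityˡ x = begin
      1# * x                 ≡⟨ cong (1# *_) (mod-toℕ x) ⟨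
      1# * (toℕ x mod n)     ≡⟨ *-mod 1 _ ⟩
      (1 ℕ.* toℕ x) mod n    ≡⟨ cong (_mod n) (ℕ.*-identityˡ (toℕ x)) ⟩
      toℕ x mod n            ≡⟨ mod-toℕ x ⟩
      x                      ∎

    -‿inverseˡ : ∀ x → - x + x ≡ 0#
    -‿inverseˡ x = begin
      - x + x                         ≡⟨ cong (- x +_) (mod-toℕ x) ⟨
      - x + (toℕ x mod n)             ≡⟨ +-mod _ _ ⟩
      (n ℕ.∸ toℕ x ℕ.+ toℕ x) mod n   ≡⟨ cong (_mod n) (ℕ.m∸n+n≡m (ℕ.<⇒≤ (Fin.toℕ<n x))) ⟩
      n mod n                         ≡⟨ mod-cong n 0 ([m+n]%n≡m%n 0 n) ⟩
      0#                              ∎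

    *-distribˡ-+ : ∀ x y z → x * (y + z) ≡ x * y + x * z
    *-distribˡ-+ x y z = begin
      x * (y + z)                                   ≡⟨ cong (_* (y + z)) (mod-toℕ x) ⟨
      (toℕ x mod n) * (y + z)                       ≡⟨ *-mod _ _ ⟩
      (toℕ x ℕ.* (toℕ y ℕ.+ toℕ z)) mod n           ≡⟨ cong (_mod n) (ℕ.*-distribˡ-+ (toℕ x) (toℕ y) (toℕ z)) ⟩
      (toℕ x ℕ.* toℕ y ℕ.+ toℕ x ℕ.* toℕ z) mod n   ≡⟨ +-mod _ _ ⟨
      x * y + x * z                                 ∎

  commutativeRing : CommutativeRing 0ℓ 0ℓ
  commutativeRing = record
    { Carrier = Fin n
    ; _≈_     = _≡_
    ; _+_     = _+_
    ; _*_     = _*_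
    ; -_      = -_
    ; 0#      = 0#
    ; 1#      = 1#
    ; isCommutativeRing = record
      { isRing = record
        { +-isAbelianGroup = record
          { isGroup = record
            { isMonoid = record
              { isSemigroup = record
                { isMagma = record { isEquivalence = isEquivalence ; ∙-cong = cong₂ _+_ }
                ; assoc   = +-assoc
                }
              ; identity = +-identityˡ , λ x → trans (+-comm x 0#) (+-identityˡ x)
              }
            ; inverse = -‿inverseˡ , λ x → trans (+-comm x (- x)) (-‿inverseˡ x)
            ; ⁻¹-cong = cong -_
            }
          ; comm = +-comm
          }
        ; *-cong     = cong₂ _*_
        ; *-assoc    = *-assoc
        ; *-identity = *-identityˡ , λ x → trans (*-comm x 1#) (*-identityˡ x)
        ; distrib    = *-distribˡ-+ , λ x y z → trans (*-comm (y + z) x)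
            (trans (*-distribˡ-+ x y z) (cong₂ _+_ (*-comm x y) (*-comm x z)))
        }
      ; *-comm = *-comm
      }
    }

module _ (p : ℕ) (prime : Prime p) where

  private
    instance
      p≢0 : NonZero p
      p≢0 = prime⇒nonZero prime

    module R = CommutativeRing (Residue.commutativeRing p)
    open Residue p
    open import Algebra.Properties.Ring R.ring
      using (-‿distribˡ-*; +-inverseˡ-unique; x≈y⇒x∙y⁻¹≈ε; x∙y⁻¹≈ε⇒x≈y)
    open DecSetoidProperties (Fin.≡-decSetoid p)
      using (≉-isApartnessRelation; ≉-tight)
    open ≡-Reasoning

    0≢1 : 0# ≢ 1#
    0≢1 eq = ℕ.0≢1+n (begin
      0          ≡⟨ m<n⇒m%n≡m (ℕ.<-trans ℕ.z<s 1<p) ⟨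
      0 % p      ≡⟨ Fin.toℕ-fromℕ< (m%n<n 0 p) ⟨
      toℕ 0#     ≡⟨ cong toℕ eq ⟩
      toℕ 1#     ≡⟨ Fin.toℕ-fromℕ< (m%n<n 1 p) ⟩
      1 % p      ≡⟨ m<n⇒m%n≡m 1<p ⟩
      1          ∎)
      where
      1<p : 1 < p
      1<p = ℕ.nonTrivial⇒n>1 p {{prime⇒nonTrivial prime}}

    leftInverse : ∀ x → x ≢ 0# → ∃[ y ] y * x ≡ 1#
    leftInverse x x≢0 with Coprimality.coprime-Bézout
      (Coprimality.prime⇒coprime prime {{x≢0′}} (Fin.toℕ<n x))
      where
      x≢0′ : NonZero (toℕ x)
      x≢0′ = ℕ.≢-nonZero (λ eq → x≢0 (trans (sym (mod-toℕ x)) (cong (_mod p) eq)))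
    ... | Bézout.+- u v eq = - (v mod p) , (begin
      - (v mod p) * x           ≡⟨ -‿distribˡ-* (v mod p) x ⟨
      - ((v mod p) * x)         ≡⟨ +-inverseˡ-unique 1# _ 1+vx≡0 ⟨
      1#                        ∎)
      where
      1+vx≡0 : 1# + (v mod p) * x ≡ 0#
      1+vx≡0 = begin
        1# + (v mod p) * x                ≡⟨ cong (λ y → 1# + (v mod p) * y) (mod-toℕ x) ⟨
        1# + (v mod p) * (toℕ x mod p)    ≡⟨ cong (1# +_) (*-mod v (toℕ x)) ⟩
        1# + (v ℕ.* toℕ x) mod p          ≡⟨ +-mod 1 _ ⟩
        (1 ℕ.+ v ℕ.* toℕ x) mod p         ≡⟨ cong (_mod p) eq ⟩
        (u ℕ.* p) mod p                   ≡⟨ mod-cong (u ℕ.* p) 0 ([m+kn]%n≡m%n 0 u p) ⟩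
        0#                                ∎
    ... | Bézout.-+ u v eq = v mod p , (begin
      (v mod p) * x               ≡⟨ cong ((v mod p) *_) (mod-toℕ x) ⟨
      (v mod p) * (toℕ x mod p)   ≡⟨ *-mod v (toℕ x) ⟩
      (v ℕ.* toℕ x) mod p         ≡⟨ cong (_mod p) eq ⟨
      (1 ℕ.+ u ℕ.* p) mod p       ≡⟨ mod-cong (1 ℕ.+ u ℕ.* p) 1 ([m+kn]%n≡m%n 1 u p) ⟩
      1#                          ∎)

    ≢⇒invertible : ∀ {x y} → x ≢ y → Invertible _≡_ 1# _*_ (x R.- y)
    ≢⇒invertible {x} {y} x≢y with leftInverse (x R.- y) (x≢y ∘ x∙y⁻¹≈ε⇒x≈y x y)
    ... | z , zd≡1 = z , zd≡1 , trans (R.*-comm _ z) zd≡1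

    invertible⇒≢ : ∀ {x y} → Invertible _≡_ 1# _*_ (x R.- y) → x ≢ y
    invertible⇒≢ {x} {y} (z , zd≡1 , _) x≡y = 0≢1 (begin
      0#              ≡⟨ R.zeroʳ z ⟨
      z * 0#          ≡⟨ cong (z *_) (x≈y⇒x∙y⁻¹≈ε x≡y) ⟨
      z * (x R.- y)   ≡⟨ zd≡1 ⟩
      1#              ∎)

  GF : HeytingField 0ℓ 0ℓ 0ℓ
  GF = record
    { Carrier = Fin p
    ; _≈_     = _≡_
    ; _#_     = _≢_
    ; _+_     = _+_
    ; _*_     = _*_
    ; -_      = -_
    ; 0#      = 0#
    ; 1#      = 1#
    ; isHeytingField = record
      { isHeytingCommutativeRing = record
        { isCommutativeRing   = R.isCommutativeRing
        ; isApartnessRelation = ≉-isApartnessRelation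
        ; #⇒invertible        = ≢⇒invertible
        ; invertible⇒#        = invertible⇒≢
        }
      ; tight = ≉-tight
      }
    }

-- Every finite matroid is isomorphic to one on Fin n.  Classically the
-- independent sets form a subset of the power set; indep? is the
-- constructive counterpart of that.
record Matroid (n : ℕ) : Set₁ where
  field
    Indep       : Pred (Subset n) 0ℓ
    indep?      : Decidable Indep
    indep-⊥     : Indep ⊥
    indep-⊆     : ∀ {I J} → I ⊆ J → Indep J → Indep I
    indep-augm  : ∀ {I J} → Indep I → Indep J → ∣ I ∣ < ∣ J ∣ →
                  ∃[ x ] x ∈ J × x ∉ I × Indep (I ∪ ⁅ x ⁆)

subsets : ∀ n → List (Subset n)
subsets zero    = List.[ [] ]
subsets (suc n) =
  List.map (inside ∷_) (subsets n) ++ List.map (outside ∷_) (subsets n)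

∈-subsets : (X : Subset n) → X List.∈ subsets n
∈-subsets []            = here refl
∈-subsets (inside  ∷ X) = ∈-++⁺ˡ (∈-map⁺ (inside ∷_) (∈-subsets X))
∈-subsets {suc n} (outside ∷ X) =
  ∈-++⁺ʳ (List.map (inside ∷_) (subsets n)) (∈-map⁺ (outside ∷_) (∈-subsets X))

ℕ⁺-totalOrder : TotalOrder 0ℓ 0ℓ 0ℓ
ℕ⁺-totalOrder = record { isTotalOrder = ≤⁺-isTotalOrder-≡ ℕ.≤-isTotalOrder }

module _ (M : Matroid n) where
  open Matroid M

  -- The default 0 is attained: the empty set is independent.
  rank : Subset n → ℕ
  rank X = ℕ-Extrema.max 0
    (List.map ∣_∣ (filter (λ I → (I ⊆? X) ×-dec indep? I) (subsets n)))

  Flat : Subset n → Set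
  Flat F = ∀ e → e ∉ F → rank F < rank (F ∪ ⁅ e ⁆)

  Circuit : Subset n → Set
  Circuit C = ¬ Indep C × (∀ D → D ⊂ C → Indep D)

  circuit? : Decidable Circuit
  circuit? C = ¬? (indep? C) ×-dec
    map′ (λ none D D⊂C → decidable-stable (indep? D) λ ¬indep → none (D , D⊂C , ¬indep))
         (λ { all (D , D⊂C , ¬indep) → ¬indep (all D D⊂C) })
         (¬? (anySubset? λ D → (D ⊂? C) ×-dec ¬? (indep? D)))

  -- ⊤⁺ plays the role of ∞, the minimum of the empty list.
  girth : ℕ ⁺
  girth = Data.List.Extrema.min ℕ⁺-totalOrder ⊤⁺
    (List.map (λ C → [ ∣ C ∣ ]) (filter circuit? (subsets n)))

  Loop : Fin n → Set
  Loop e = Circuit ⁅ e ⁆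

  Parallel : Fin n → Fin n → Set
  Parallel e f = e ≢ f × Circuit (⁅ e ⁆ ∪ ⁅ f ⁆)

  Simple : Set
  Simple = (∀ e → ¬ Loop e) × (∀ e f → ¬ Parallel e f)

module _ (F : HeytingField c ℓ₁ ℓ₂) where
  open HeytingField F
  open import Algebra.Properties.Monoid.Sum
    (CommutativeRing.+-monoid (HeytingCommutativeRing.commutativeRing heytingCommutativeRing)) using (sum)

  -- Linear independence of the indexed family (v e), e ∈ X: coefficients
  -- are given on all of Fin n but vanish outside X.
  LinearlyIndependent : ∀ {m} → (Fin n → Vector Carrier m) → Subset n → Set _
  LinearlyIndependent {n} v X =
    (a : Fin n → Carrier) → (∀ e → e ∉ X → a e ≈ 0#) →
    (∀ i → sum (λ e → a e * v e i) ≈ 0#) → ∀ e → a e ≈ 0#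

  Representable : Matroid n → Set _
  Representable {n} M = ∃[ m ] Σ[ v ∈ (Fin n → Vector Carrier m) ]
    (∀ X → Matroid.Indep M X ⇔ LinearlyIndependent v X)

{-# OPTIONS --safe #-}

-- Inside an independent set B of size at least p^k + k, a set S is grown
-- greedily so that S ∪ {e} stays independent for every element e.  If no
-- j ∈ B ─ S can be added, then for each j some e_j makes S ∪ {j, e_j}
-- dependent.  There are at most p^∣S∣ restrictions to S of the resulting
-- linear relations, so two of these relations, for j ≠ j′, agree on S.  Their
-- difference is a nontrivial relation on {j, j′, e_j, e_j′}, against the girth.

module Submission where

open import Defs
open import Algebra.Apartness.Bundles using (HeytingField; HeytingCommutativeRing)
open import Algebra.Bundles using (CommutativeRing)
import Algebra.Properties.Ring as RingProperties
import Algebra.Properties.Semiring.Sum as SemiringSum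
open import Data.Fin.Base using (Fin; zero; suc; finToFun; funToFin)
import Data.Fin.Properties as Fin
open import Data.Fin.Subset
  using (Subset; inside; outside; ∣_∣; _∈_; _∉_; _⊆_; ⊥; ⊤; _∪_; _─_; ⁅_⁆)
open import Data.Fin.Subset.Induction using (⊂-wellFounded; Acc; acc)
open import Data.Fin.Subset.Properties
import Data.List.Base as List
import Data.List.Extrema
import Data.List.Extrema.Nat as ℕ-Extrema
open import Data.List.Membership.Propositional.Properties
  using (∈-map∘filter⁺; ∈-map∘filter⁻)
import Data.List.Relation.Unary.All as All
open import Data.Nat.Base using (ℕ; zero; suc; _+_; _^_; _≤_; _<_; z≤n; s≤s)
open import Data.Nat.Primality using (Prime; prime⇒nonZero)
import Data.Nat.Properties as ℕ
open import Data.Product.Base using (∃-syntax; _×_; _,_; proj₁; proj₂)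
open import Data.Sum.Base using (inj₁; inj₂; [_,_]′)
open import Data.Vec.Base using ([]; _∷_; here; there)
open import Data.Vec.Functional using (Vector)
open import Function.Base using (_∘_)
open import Function.Bundles using (module Equivalence)
open import Relation.Binary.Construct.Add.Supremum.NonStrict _≤_ using (_≤⁺_; ≤⁺-trans; [≤]-injective)
open import Relation.Nullary.Construct.Add.Supremum using ([_])
open import Relation.Binary.PropositionalEquality
  using (_≡_; _≢_; _≗_; refl; sym; trans; cong; cong₂; subst; subst₂; module ≡-Reasoning)
open import Relation.Nullary.Decidable
  using (Dec; yes; no; ¬?; _×-dec_; _→-dec_; decidable-stable)
open import Relation.Nullary.Negation using (¬_; contradiction)

private
  variable
    n : ℕ

-- Cardinalities of unions and differences of subsets.

∣p∪q∣≤∣p∣+∣q∣ : (p q : Subset n) → ∣ p ∪ q ∣ ≤ ∣ p ∣ + ∣ q ∣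
∣p∪q∣≤∣p∣+∣q∣ []            []            = z≤n
∣p∪q∣≤∣p∣+∣q∣ (outside ∷ p) (outside ∷ q) = ∣p∪q∣≤∣p∣+∣q∣ p q
∣p∪q∣≤∣p∣+∣q∣ (outside ∷ p) (inside  ∷ q) =
  ℕ.≤-trans (s≤s (∣p∪q∣≤∣p∣+∣q∣ p q)) (ℕ.≤-reflexive (sym (ℕ.+-suc ∣ p ∣ ∣ q ∣)))
∣p∪q∣≤∣p∣+∣q∣ (inside  ∷ p) (outside ∷ q) = s≤s (∣p∪q∣≤∣p∣+∣q∣ p q)
∣p∪q∣≤∣p∣+∣q∣ (inside  ∷ p) (inside  ∷ q) =
  s≤s (ℕ.≤-trans (∣p∪q∣≤∣p∣+∣q∣ p q) (ℕ.+-monoʳ-≤ ∣ p ∣ (ℕ.n≤1+n ∣ q ∣)))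

∣p∪⁅x⁆∣≤1+∣p∣ : (p : Subset n) (x : Fin n) → ∣ p ∪ ⁅ x ⁆ ∣ ≤ suc ∣ p ∣
∣p∪⁅x⁆∣≤1+∣p∣ p x = begin
  ∣ p ∪ ⁅ x ⁆ ∣       ≤⟨ ∣p∪q∣≤∣p∣+∣q∣ p ⁅ x ⁆ ⟩
  ∣ p ∣ + ∣ ⁅ x ⁆ ∣   ≡⟨ cong (∣ p ∣ +_) (∣⁅x⁆∣≡1 x) ⟩
  ∣ p ∣ + 1           ≡⟨ ℕ.+-comm ∣ p ∣ 1 ⟩
  suc ∣ p ∣           ∎
  where open ℕ.≤-Reasoning

x∉p⇒∣p∪⁅x⁆∣≡1+∣p∣ : {p : Subset n} {x : Fin n} → x ∉ p → ∣ p ∪ ⁅ x ⁆ ∣ ≡ suc ∣ p ∣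
x∉p⇒∣p∪⁅x⁆∣≡1+∣p∣ {p = p} {x} x∉p = ℕ.≤-antisym (∣p∪⁅x⁆∣≤1+∣p∣ p x)
  (p⊂q⇒∣p∣<∣q∣ (p⊆p∪q ⁅ x ⁆ , x , q⊆p∪q p ⁅ x ⁆ (x∈⁅x⁆ x) , x∉p))

∣q∣≤∣p∣+∣q─p∣ : (p q : Subset n) → ∣ q ∣ ≤ ∣ p ∣ + ∣ q ─ p ∣
∣q∣≤∣p∣+∣q─p∣ p q = ℕ.≤-trans (p⊆q⇒∣p∣≤∣q∣ q⊆p∪q─p) (∣p∪q∣≤∣p∣+∣q∣ p (q ─ p))
  where
  q⊆p∪q─p : q ⊆ p ∪ (q ─ p)
  q⊆p∪q─p {x} x∈q with x ∈? p
  ... | yes x∈p = x∈p∪q⁺ (inj₁ x∈p)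
  ... | no  x∉p = x∈p∪q⁺ (inj₂ (x∈p∧x∉q⇒x∈p─q x∈q x∉p))

p∪⁅x⁆⊆q : {p q : Subset n} {x : Fin n} → p ⊆ q → x ∈ q → p ∪ ⁅ x ⁆ ⊆ q
p∪⁅x⁆⊆q {p = p} {q} {x} p⊆q x∈q =
  [ p⊆q , (λ y∈⁅x⁆ → subst (_∈ q) (sym (x∈⁅y⁆⇒x≡y x y∈⁅x⁆)) x∈q) ]′ ∘ x∈p∪q⁻ p ⁅ x ⁆

x∉p∪⁅y⁆ : {p : Subset n} {x y : Fin n} → x ∉ p → x ≢ y → x ∉ p ∪ ⁅ y ⁆
x∉p∪⁅y⁆ {p = p} {y = y} x∉p x≢y = [ x∉p , x≢y⇒x∉⁅y⁆ x≢y ]′ ∘ x∈p∪q⁻ p ⁅ y ⁆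

x∈p─q⇒x∉q : {p q : Subset n} {x : Fin n} → x ∈ p ─ q → x ∉ q
x∈p─q⇒x∉q {p = _ ∷ _} {outside ∷ _} (there x∈p─q) (there x∈q) = x∈p─q⇒x∉q x∈p─q x∈q
x∈p─q⇒x∉q {p = _ ∷ _} {inside  ∷ _} (there x∈p─q) (there x∈q) = x∈p─q⇒x∉q x∈p─q x∈q

-- Codes of functions and enumeration of subsets.

funToFin-injective : ∀ {k m} {f g : Fin k → Fin m} → funToFin f ≡ funToFin g → f ≗ g
funToFin-injective {f = f} {g} eq i = begin
  f i                       ≡⟨ Fin.finToFun-funToFin f i ⟨
  finToFun (funToFin f) i   ≡⟨ cong (λ c → finToFun c i) eq ⟩
  finToFun (funToFin g) i   ≡⟨ Fin.finToFun-funToFin g i ⟩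
  g i                       ∎
  where open ≡-Reasoning

-- The increasing enumeration of `S`. It turns coefficients on `S` into a function on `Fin ∣ S ∣`,
-- which has a code in `Fin (p ^ ∣ S ∣)`.
elements : (S : Subset n) → Fin ∣ S ∣ → Fin n
elements (inside  ∷ S) zero    = zero
elements (inside  ∷ S) (suc i) = suc (elements S i)
elements (outside ∷ S) i       = suc (elements S i)

elements-∈ : (S : Subset n) (i : Fin ∣ S ∣) → elements S i ∈ S
elements-∈ (inside  ∷ S) zero    = here
elements-∈ (inside  ∷ S) (suc i) = there (elements-∈ S i)
elements-∈ (outside ∷ S) i       = there (elements-∈ S i)

elements-injective : (S : Subset n) {i j : Fin ∣ S ∣} → elements S i ≡ elements S j → i ≡ j
elements-injective (inside  ∷ S) {zero}  {zero}  eq = refl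
elements-injective (inside  ∷ S) {suc i} {suc j} eq =
  cong suc (elements-injective S (Fin.suc-injective eq))
elements-injective (outside ∷ S) eq = elements-injective S (Fin.suc-injective eq)

elements-surjective : (S : Subset n) {x : Fin n} → x ∈ S → ∃[ i ] elements S i ≡ x
elements-surjective (inside  ∷ S) here = zero , refl
elements-surjective (inside  ∷ S) (there x∈S) with elements-surjective S x∈S
... | i , eq = suc i , cong suc eq
elements-surjective (outside ∷ S) (there x∈S) with elements-surjective S x∈S
... | i , eq = i , cong suc eq

-- Rank, girth and flats.

module _ (M : Matroid n) where
  open Matroid M

  indepIn? : ∀ X I → Dec (I ⊆ X × Indep I)
  indepIn? X I = (I ⊆? X) ×-dec indep? I

  rank-attained : ∀ X → ∃[ I ] I ⊆ X × Indep I × ∣ I ∣ ≡ rank M X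
  rank-attained X with ℕ-Extrema.argmax-sel (λ m → m) 0
    (List.map ∣_∣ (List.filter (indepIn? X) (subsets n)))
  -- The maximum may be its default value 0, which the empty set attains.
  ... | inj₁ rank≡0 = ⊥ , (λ x∈⊥ → contradiction x∈⊥ ∉⊥) , indep-⊥ , trans (∣⊥∣≡0 n) (sym rank≡0)
  ... | inj₂ rank∈ with ∈-map∘filter⁻ ∣_∣ (indepIn? X) {xs = subsets n} rank∈
  ...   | I , _ , rank≡∣I∣ , I⊆X , indI = I , I⊆X , indI , sym rank≡∣I∣

  ∣I∣≤rank : ∀ {I X} → I ⊆ X → Indep I → ∣ I ∣ ≤ rank M X
  ∣I∣≤rank {I} {X} I⊆X indI = All.lookup (ℕ-Extrema.xs≤max 0 _)
    (∈-map∘filter⁺ ∣_∣ (indepIn? X) (I , ∈-subsets I , refl , I⊆X , indI))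

  indep⇒rank≡∣I∣ : ∀ {I} → Indep I → rank M I ≡ ∣ I ∣
  indep⇒rank≡∣I∣ {I} indI with rank-attained I
  ... | J , J⊆I , _ , ∣J∣≡rank = ℕ.≤-antisym
    (subst (_≤ ∣ I ∣) ∣J∣≡rank (p⊆q⇒∣p∣≤∣q∣ J⊆I))
    (∣I∣≤rank (λ x∈I → x∈I) indI)

  circuit⇒girth≤ : ∀ {C} → Circuit M C → girth M ≤⁺ [ ∣ C ∣ ]
  circuit⇒girth≤ {C} circ = All.lookup (Data.List.Extrema.min≤xs ℕ⁺-totalOrder _ _)
    (∈-map∘filter⁺ (λ C → [ ∣ C ∣ ]) (circuit? M) (C , ∈-subsets C , refl , circ))

  -- Induction on strict inclusion: all proper subsets of `X` are independent, so a dependent `X`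
  -- would be a circuit smaller than the girth.
  ∣X∣<girth⇒indep : ∀ {g} → [ g ] ≤⁺ girth M → ∀ X → ∣ X ∣ < g → Indep X
  ∣X∣<girth⇒indep {g} g≤girth X = go X (⊂-wellFounded X)
    where
    go : ∀ X → Acc _ X → ∣ X ∣ < g → Indep X
    go X (acc rec) ∣X∣<g = decidable-stable (indep? X) λ ¬indX →
      ℕ.<⇒≱ ∣X∣<g ([≤]-injective (≤⁺-trans ℕ.≤-trans g≤girth
        (circuit⇒girth≤ (¬indX , λ D D⊂X →
          go D (rec D⊂X) (ℕ.<-trans (p⊂q⇒∣p∣<∣q∣ D⊂X) ∣X∣<g)))))

  -- For an independent `S` this is equivalent to being a flat: elements `e` outside `S` raise the
  -- rank, and for `e` in `S` the condition only repeats the independence of `S`.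
  Extendable : Subset n → Set
  Extendable S = ∀ e → Indep (S ∪ ⁅ e ⁆)

  extendable? : ∀ S → Dec (Extendable S)
  extendable? S = Fin.all? (λ e → indep? (S ∪ ⁅ e ⁆))

  extendable⇒flat : ∀ {S} → Indep S → Extendable S → Flat M S
  extendable⇒flat {S} indS ext e e∉S = subst₂ _<_
    (sym (indep⇒rank≡∣I∣ indS))
    (sym (trans (indep⇒rank≡∣I∣ (ext e)) (x∉p⇒∣p∪⁅x⁆∣≡1+∣p∣ e∉S)))
    (ℕ.n<1+n ∣ S ∣)

-- Linear relations over the field with `p` elements.

module _ (p : ℕ) (prime : Prime p) where
  private
    module K = HeytingField (GF p prime)
    ring = HeytingCommutativeRing.commutativeRing K.heytingCommutativeRing
    module R = CommutativeRing ring
  open RingProperties R.ring using (-‿distribˡ-*; x∙y⁻¹≈ε⇒x≈y)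
  open SemiringSum R.semiring using (sum; sum-cong-≗; ∑-distrib-+; *-distribˡ-sum)

  SupportedOn : (Fin n → K.Carrier) → Subset n → Set
  SupportedOn a X = ∀ e → e ∉ X → a e ≡ K.0#

  LinearRelation : ∀ {m} → (Fin n → Vector K.Carrier m) → (Fin n → K.Carrier) → Set
  LinearRelation v a = ∀ i → sum (λ e → a e K.* v e i) ≡ K.0#

  linearRelation-difference : ∀ {m} (v : Fin n → Vector K.Carrier m) {a b} →
    LinearRelation v a → LinearRelation v b → LinearRelation v (λ e → a e K.- b e)
  linearRelation-difference v {a} {b} rel-a rel-b i = begin
    sum (λ e → (a e K.- b e) K.* v e i)
      ≡⟨ sum-cong-≗ (λ e → R.distribʳ (v e i) (a e) (K.- b e)) ⟩
    sum (λ e → a e K.* v e i K.+ (K.- b e) K.* v e i)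
      ≡⟨ ∑-distrib-+ (λ e → a e K.* v e i) (λ e → (K.- b e) K.* v e i) ⟩
    sum (λ e → a e K.* v e i) K.+ sum (λ e → (K.- b e) K.* v e i)
      ≡⟨ cong₂ K._+_ (rel-a i) (sum-cong-≗ (λ e → neg (b e) (v e i))) ⟩
    K.0# K.+ sum (λ e → (K.- K.1#) K.* (b e K.* v e i))
      ≡⟨ R.+-identityˡ _ ⟩
    sum (λ e → (K.- K.1#) K.* (b e K.* v e i))
      ≡⟨ *-distribˡ-sum (K.- K.1#) (λ e → b e K.* v e i) ⟨
    (K.- K.1#) K.* sum (λ e → b e K.* v e i)
      ≡⟨ cong ((K.- K.1#) K.*_) (rel-b i) ⟩
    (K.- K.1#) K.* K.0#
      ≡⟨ R.zeroʳ (K.- K.1#) ⟩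
    K.0# ∎
    where
    open ≡-Reasoning
    -- Negation becomes multiplication by a constant, which can be moved out of the sum.
    neg : ∀ x y → (K.- x) K.* y ≡ (K.- K.1#) K.* (x K.* y)
    neg x y = begin
      (K.- x) K.* y                  ≡⟨ -‿distribˡ-* x y ⟨
      K.- (x K.* y)                  ≡⟨ cong K.-_ (R.*-identityˡ (x K.* y)) ⟨
      K.- (K.1# K.* (x K.* y))       ≡⟨ -‿distribˡ-* K.1# (x K.* y) ⟩
      (K.- K.1#) K.* (x K.* y)       ∎

  -- The coefficient functions Fin n → Fin p are searched through their codes
  -- in Fin (p ^ n), since without function extensionality they cannot be
  -- enumerated directly.
  dependent⇒linearRelation : ∀ {m} (v : Fin n → Vector K.Carrier m) X →
    ¬ LinearlyIndependent (GF p prime) v X →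
    ∃[ a ] SupportedOn a X × LinearRelation v a × ∃[ e ] a e ≢ K.0#
  dependent⇒linearRelation {n} {m} v X dep with Fin.any? Nontrivial?
    where
    Nontrivial : Fin (p ^ n) → Set
    Nontrivial c = SupportedOn (finToFun c) X × LinearRelation v (finToFun c) ×
      ∃[ e ] finToFun c e ≢ K.0#

    Nontrivial? : ∀ c → Dec (Nontrivial c)
    Nontrivial? c =
      Fin.all? (λ e → ¬? (e ∈? X) →-dec (finToFun c e Fin.≟ K.0#)) ×-dec
      Fin.all? {n = m} (λ i → sum (λ e → finToFun c e K.* v e i) Fin.≟ K.0#) ×-dec
      Fin.any? (λ e → ¬? (finToFun c e Fin.≟ K.0#))
  ... | yes (c , nontrivial) = finToFun c , nontrivial
  ... | no none = contradiction independent dep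
    where
    independent : LinearlyIndependent (GF p prime) v X
    independent a supp rel e = decidable-stable (a e Fin.≟ K.0#) λ ae≢0 →
      none (funToFin a
           , (λ x x∉X → trans (code x) (supp x x∉X))
           , (λ i → trans (sum-cong-≗ (λ x → cong (K._* v x i) (code x))) (rel i))
           , e , λ eq → ae≢0 (trans (sym (code e)) eq))
      where
      code = Fin.finToFun-funToFin a

  -- The source of the bound `p ^ k + k`: removing `S` costs `B` fewer than `k` elements, so more
  -- than `p ^ k` remain, hence more than there are coefficient functions on `S`.
  p^∣S∣<∣B─S∣ : ∀ {k} (B S : Subset n) → p ^ k + k ≤ ∣ B ∣ → ∣ S ∣ < k →
    p ^ ∣ S ∣ < ∣ B ─ S ∣
  p^∣S∣<∣B─S∣ {k = k} B S large ∣S∣<k = ℕ.+-cancelˡ-≤ ∣ S ∣ _ _ (begin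
    ∣ S ∣ + suc (p ^ ∣ S ∣)   ≡⟨ ℕ.+-suc ∣ S ∣ _ ⟩
    suc ∣ S ∣ + p ^ ∣ S ∣     ≤⟨ ℕ.+-mono-≤ ∣S∣<k p^∣S∣≤p^k ⟩
    k + p ^ k                 ≡⟨ ℕ.+-comm k (p ^ k) ⟩
    p ^ k + k                 ≤⟨ large ⟩
    ∣ B ∣                     ≤⟨ ∣q∣≤∣p∣+∣q─p∣ S B ⟩
    ∣ S ∣ + ∣ B ─ S ∣         ∎)
    where
    open ℕ.≤-Reasoning
    p^∣S∣≤p^k : p ^ ∣ S ∣ ≤ p ^ k
    p^∣S∣≤p^k = ℕ.^-monoʳ-≤ p {{prime⇒nonZero prime}} (ℕ.<⇒≤ ∣S∣<k)

  -- Representable matroids of girth at least five.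

  module _ {M : Matroid n} (representable : Representable (GF p prime) M)
           ([5]≤girth : [ 5 ] ≤⁺ girth M) where
    open Matroid M
    private
      v = proj₁ (proj₂ representable)

    indep⇒trivial : ∀ {X a} → Indep X → SupportedOn a X → LinearRelation v a →
      ∀ e → a e ≡ K.0#
    indep⇒trivial {X} {a} indX = Equivalence.to (proj₂ (proj₂ representable) X) indX a

    ¬indep⇒linearRelation : ∀ X → ¬ Indep X →
      ∃[ a ] SupportedOn a X × LinearRelation v a × ∃[ e ] a e ≢ K.0#
    ¬indep⇒linearRelation X ¬indX = dependent⇒linearRelation v X
      (¬indX ∘ Equivalence.from (proj₂ (proj₂ representable) X))

    -- The four elements may coincide, so the union has at most four elements, fewer than any
    -- circuit.
    quadruple-indep : ∀ w x y z → Indep (((⁅ w ⁆ ∪ ⁅ x ⁆) ∪ ⁅ y ⁆) ∪ ⁅ z ⁆)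
    quadruple-indep w x y z = ∣X∣<girth⇒indep M [5]≤girth _ (s≤s (begin
      ∣ ((⁅ w ⁆ ∪ ⁅ x ⁆) ∪ ⁅ y ⁆) ∪ ⁅ z ⁆ ∣   ≤⟨ ∣p∪⁅x⁆∣≤1+∣p∣ ((⁅ w ⁆ ∪ ⁅ x ⁆) ∪ ⁅ y ⁆) z ⟩
      1 + ∣ (⁅ w ⁆ ∪ ⁅ x ⁆) ∪ ⁅ y ⁆ ∣         ≤⟨ s≤s (∣p∪⁅x⁆∣≤1+∣p∣ (⁅ w ⁆ ∪ ⁅ x ⁆) y) ⟩
      2 + ∣ ⁅ w ⁆ ∪ ⁅ x ⁆ ∣                   ≤⟨ s≤s (s≤s (∣p∪⁅x⁆∣≤1+∣p∣ ⁅ w ⁆ x)) ⟩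
      3 + ∣ ⁅ w ⁆ ∣                           ≡⟨ cong (3 +_) (∣⁅x⁆∣≡1 w) ⟩
      4                                       ∎))
      where open ℕ.≤-Reasoning

    -- A witness that `S ∪ ⁅ j ⁆` is not extendable. The field `dependent` is kept beside the
    -- relation because it later separates `e` from the other elements of `B`.
    record Obstruction (S : Subset n) (j : Fin n) : Set where
      field
        e         : Fin n
        dependent : ¬ Indep ((S ∪ ⁅ j ⁆) ∪ ⁅ e ⁆)
        a         : Fin n → K.Carrier
        support   : SupportedOn a ((S ∪ ⁅ j ⁆) ∪ ⁅ e ⁆)
        relation  : LinearRelation v a
        a[j]≢0    : a j ≢ K.0#

    -- If the coefficient at `j` were zero, the relation would live on `S ∪ ⁅ e ⁆`, which is
    -- independent as `S` is extendable, and so would be trivial.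
    obstruction : ∀ {S j} → Extendable M S → ¬ Extendable M (S ∪ ⁅ j ⁆) → Obstruction S j
    obstruction {S} {j} ext ¬ext
      with e , dependent ← Fin.¬∀⟶∃¬ n _ (λ e → indep? ((S ∪ ⁅ j ⁆) ∪ ⁅ e ⁆)) ¬ext
      with a , support , relation , x , a[x]≢0 ← ¬indep⇒linearRelation _ dependent
      = record
        { e = e ; dependent = dependent ; a = a ; support = support ; relation = relation
        ; a[j]≢0 = λ a[j]≡0 → a[x]≢0 (indep⇒trivial (ext e) (support-S∪e a[j]≡0) relation x)
        }
      where
      support-S∪e : a j ≡ K.0# → SupportedOn a (S ∪ ⁅ e ⁆)
      support-S∪e a[j]≡0 y y∉S∪e with y Fin.≟ j
      ... | yes refl = a[j]≡0
      ... | no  y≢j  = support y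
        (x∉p∪⁅y⁆ (x∉p∪⁅y⁆ (y∉S∪e ∘ p⊆p∪q ⁅ e ⁆) y≢j)
                  (x∉⁅y⁆⇒x≢y (y∉S∪e ∘ q⊆p∪q S ⁅ e ⁆)))

    -- Agreement on `S` leaves the difference supported on four elements, so it vanishes by the
    -- girth bound. But at `j` the first relation is nonzero, while the second is zero because `j`
    -- lies outside `S ∪ {k, e_k}`.
    obstructions-disagree : ∀ {B S j k} → Indep B → S ⊆ B → j ∈ B → k ∈ B → j ∉ S → j ≢ k →
      (oj : Obstruction S j) (ok : Obstruction S k) →
      ¬ (∀ x → x ∈ S → Obstruction.a oj x ≡ Obstruction.a ok x)
    obstructions-disagree {B} {S} {j} {k} indB S⊆B j∈B k∈B j∉S j≢k oj ok agree =
      oj.a[j]≢0 (trans a[j]≡b[j] b[j]≡0)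
      where
      module oj = Obstruction oj
      module ok = Obstruction ok
      Q = ((⁅ j ⁆ ∪ ⁅ k ⁆) ∪ ⁅ oj.e ⁆) ∪ ⁅ ok.e ⁆

      difference-support : SupportedOn (λ x → oj.a x K.- ok.a x) Q
      difference-support x x∉Q with x ∈? S
      ... | yes x∈S = trans (cong (K._- ok.a x) (agree x x∈S)) (R.-‿inverseʳ (ok.a x))
      ... | no  x∉S = trans (cong₂ K._-_
              (oj.support x (x∉p∪⁅y⁆ (x∉p∪⁅y⁆ x∉S x≢j) x≢ej))
              (ok.support x (x∉p∪⁅y⁆ (x∉p∪⁅y⁆ x∉S x≢k) x≢ek)))
            (R.-‿inverseʳ K.0#)
        where
        x≢ek = x∉⁅y⁆⇒x≢y (x∉Q ∘ q⊆p∪q _ _)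
        x≢ej = x∉⁅y⁆⇒x≢y (x∉Q ∘ p⊆p∪q _ ∘ q⊆p∪q _ _)
        x≢k  = x∉⁅y⁆⇒x≢y (x∉Q ∘ p⊆p∪q _ ∘ p⊆p∪q _ ∘ q⊆p∪q _ _)
        x≢j  = x∉⁅y⁆⇒x≢y (x∉Q ∘ p⊆p∪q _ ∘ p⊆p∪q _ ∘ p⊆p∪q _)

      a[j]≡b[j] : oj.a j ≡ ok.a j
      a[j]≡b[j] = x∙y⁻¹≈ε⇒x≈y _ _ (indep⇒trivial (quadruple-indep j k oj.e ok.e)
        difference-support (linearRelation-difference v {oj.a} {ok.a} oj.relation ok.relation) j)

      -- Otherwise S ∪ {k, e_k} lies in the independent set B.
      j≢ek : j ≢ ok.e
      j≢ek j≡ek = ok.dependent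
        (indep-⊆ (p∪⁅x⁆⊆q (p∪⁅x⁆⊆q S⊆B k∈B) (subst (_∈ B) j≡ek j∈B)) indB)

      b[j]≡0 : ok.a j ≡ K.0#
      b[j]≡0 = ok.support j (x∉p∪⁅y⁆ (x∉p∪⁅y⁆ j∉S j≢k) j≢ek)

    -- Greedy growth of an extendable set.

    extend : ∀ {B S} → Indep B → S ⊆ B → p ^ ∣ S ∣ < ∣ B ─ S ∣ → Extendable M S →
      ∃[ j ] j ∈ B × j ∉ S × Extendable M (S ∪ ⁅ j ⁆)
    extend {B} {S} indB S⊆B p^∣S∣<∣B─S∣ ext
      with Fin.any? (λ j → (j ∈? B ─ S) ×-dec extendable? M (S ∪ ⁅ j ⁆))
    ... | yes (j , j∈B─S , ext′) = j , p─q⊆p B S j∈B─S , x∈p─q⇒x∉q j∈B─S , ext′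
    ... | no none = contradiction agree (obstructions-disagree indB S⊆B
            (∈B i) (∈B i′) (x∈p─q⇒x∉q (elements-∈ (B ─ S) i))
            (Fin.<⇒≢ i<i′ ∘ elements-injective (B ─ S)) (obs i) (obs i′))
      where
      obs : ∀ i → Obstruction S (elements (B ─ S) i)
      obs i = obstruction ext λ ext′ → none (_ , elements-∈ (B ─ S) i , ext′)

      restriction : Fin ∣ B ─ S ∣ → Fin ∣ S ∣ → Fin p
      restriction i = Obstruction.a (obs i) ∘ elements S

      -- The pigeonholes are the `p ^ ∣ S ∣` codes of functions on `S`; equal codes then give
      -- pointwise agreement.
      collision = Fin.pigeonhole p^∣S∣<∣B─S∣ (funToFin ∘ restriction)
      i      = proj₁ collision
      i′     = proj₁ (proj₂ collision)
      i<i′   = proj₁ (proj₂ (proj₂ collision))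
      same   = proj₂ (proj₂ (proj₂ collision))

      ∈B : ∀ i → elements (B ─ S) i ∈ B
      ∈B i = p─q⊆p B S (elements-∈ (B ─ S) i)

      agree : ∀ x → x ∈ S → Obstruction.a (obs i) x ≡ Obstruction.a (obs i′) x
      agree x x∈S = let s , s≡x = elements-surjective S x∈S in
        subst (λ y → Obstruction.a (obs i) y ≡ Obstruction.a (obs i′) y) s≡x
          (funToFin-injective {f = restriction i} {restriction i′} same s)

    -- The induction runs on the size `t` while `k` stays fixed, so that the one bound on `∣ B ∣`
    -- serves every stage.
    grow : ∀ {B k} → Indep B → p ^ k + k ≤ ∣ B ∣ → ∀ t → t ≤ k →
      ∃[ S ] S ⊆ B × ∣ S ∣ ≡ t × Extendable M S
    grow indB large zero t≤k = ⊥ , (λ x∈⊥ → contradiction x∈⊥ ∉⊥) , ∣⊥∣≡0 n , λ e →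
      indep-⊆ (p∪⁅x⁆⊆q (λ x∈⊥ → contradiction x∈⊥ ∉⊥) (q⊆p∪q _ ⁅ e ⁆ (x∈⁅x⁆ e)))
        (quadruple-indep e e e e)
    grow {B} {k} indB large (suc t) t<k
      with S , S⊆B , refl , ext ← grow indB large t (ℕ.<⇒≤ t<k)
      with j , j∈B , j∉S , ext′ ← extend indB S⊆B (p^∣S∣<∣B─S∣ B S large t<k) ext
      = S ∪ ⁅ j ⁆ , p∪⁅x⁆⊆q S⊆B j∈B , x∉p⇒∣p∪⁅x⁆∣≡1+∣p∣ j∉S , ext′

corollary1p3 : (p : ℕ) (prime : Prime p) (k : ℕ) → 1 ≤ k →
    ∃[ N ] (∀ {n} (M : Matroid n) →
    Simple M → Representable (GF p prime) M →
    N ≤ rank M ⊤ → [ 5 ] ≤⁺ girth M →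
    ∃[ F ] Flat M F × rank M F ≡ k × Matroid.Indep M F)
corollary1p3 p p-prime k _ = p ^ k + k , λ M _ representable N≤rank [5]≤girth →
  -- `B` is a basis of `M`, so the rank hypothesis bounds its size from below.
  let B , _ , indB , ∣B∣≡rank = rank-attained M ⊤
      S , S⊆B , ∣S∣≡k , ext   = grow p p-prime {M = M} representable [5]≤girth indB
                                  (subst (p ^ k + k ≤_) (sym ∣B∣≡rank) N≤rank) k ℕ.≤-refl
      indS                    = Matroid.indep-⊆ M S⊆B indB
  in S , extendable⇒flat M indS ext , trans (indep⇒rank≡∣I∣ M indS) ∣S∣≡k , indS
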